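{- (i) The unimodal spi-logic $\mathsf{SPi}+\{\iota_{sym}\}$ is complex, and hence complete. (ii) $\mathsf{SPi}+\{\iota_{refl},\iota_{trans},\iota_{sym}\}=\mathsf{SPi}+\{\iota_{refl},\iota_{trans},\iota_{eucl}\}$, and this spi-logic is complex, and hence complete.
   Context: Unimodal setting: one diamond $\Diamond$. Sp-formulas: built from propositional variables and $\top$ by $\wedge$ and $\Diamond$; sp-implications $\sigma\to\tau$. A SLO is an algebra $(A,\wedge,\top,\Diamond)$ with $(A,\wedge,\top)$ a meet-semilattice with top and $\Diamond$ monotone; it validates $\sigma\to\tau$ if $\sigma[\mathfrak a]\le\tau[\mathfrak a]$ for all valuations. Frames $(W,R)$ with standard Kripke semantics. $\mathsf{SPi}+\Sigma$ is the set of sp-implications valid in every SLO validating $\Sigma$; it is complete if it equals the set of sp-implications valid in every frame validating $\Sigma$. For a frame $\mathfrak F=(W,R)$, $\mathfrak F^\star=(2^W,\cap,W,\Diamond^+)$ with $\Diamond^+X=\{w\mid\exists v\in X,(w,v)\in R\}$; a spi-logic $L$ is complex if every SLO validating $L$ embeds (injectively, preserving $\wedge,\top,\Diamond$) into $\mathfrak F^\star$ for some frame $\mathfrak F$ validating $L$. Notation: $\iota_{refl}=(p\to\Diamond p)$, $\iota_{trans}=(\Diamond\Diamond p\to\Diamond p)$, $\iota_{sym}=(q\wedge\Diamond p\to\Diamond(p\wedge\Diamond q))$, $\iota_{eucl}=(\Diamond p\wedge\Diamond q\to\Diamond(p\wedge\Diamond q))$. -}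

module Defs where

open import Level using (Level; suc; _⊔_; 0ℓ)
open import Data.Nat.Base using (ℕ)
open import Data.Product.Base using (Σ; ∃; _×_; _,_; proj₁; proj₂)
open import Data.Unit.Polymorphic.Base as Unit using (tt)
open import Function.Definitions using (Congruent; Injective)
open import Relation.Binary.Core using (Rel)
open import Relation.Binary.Definitions using (Monotonic₁)
open import Relation.Binary.Lattice.Bundles using (BoundedMeetSemilattice)
open import Relation.Unary using (Pred; _∈_; _⊆_; _∩_; _∪_; _≐_; ｛_｝)
open import Relation.Unary.Relation.Binary.Subset using (⊆-isPartialOrder)

infixr 7 _∧'_
infix  4 _⇒'_

data Form : Set where
  var  : ℕ → Form
  ⊤'   : Form
  _∧'_ : Form → Form → Form
  ◇'_  : Form → Form

infix 8 ◇'_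

record SpImp : Set where
  constructor _⇒'_
  field
    ante : Form
    cons : Form

p q : Form
p = var 0
q = var 1

ι-refl ι-trans ι-sym ι-eucl : SpImp
ι-refl  = p ⇒' ◇' p
ι-trans = ◇' ◇' p ⇒' ◇' p
ι-sym   = q ∧' ◇' p ⇒' ◇' (p ∧' ◇' q)
ι-eucl  = ◇' p ∧' ◇' q ⇒' ◇' (p ∧' ◇' q)

record SLO c ℓ₁ ℓ₂ : Set (suc (c ⊔ ℓ₁ ⊔ ℓ₂)) where
  field
    boundedMeetSemilattice : BoundedMeetSemilattice c ℓ₁ ℓ₂

  open BoundedMeetSemilattice boundedMeetSemilattice public

  field
    ◇      : Carrier → Carrier
    ◇-mono : Monotonic₁ _≤_ _≤_ ◇

module _ {c ℓ₁ ℓ₂} (A : SLO c ℓ₁ ℓ₂) where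
  open SLO A

  eval : (ℕ → Carrier) → Form → Carrier
  eval 𝔞 (var i)  = 𝔞 i
  eval 𝔞 ⊤'       = ⊤
  eval 𝔞 (σ ∧' τ) = eval 𝔞 σ ∧ eval 𝔞 τ
  eval 𝔞 (◇' σ)   = ◇ (eval 𝔞 σ)

  ValidSLO : SpImp → Set (c ⊔ ℓ₂)
  ValidSLO (σ ⇒' τ) = ∀ (𝔞 : ℕ → Carrier) → eval 𝔞 σ ≤ eval 𝔞 τ

-- Frames have a nonempty set of worlds, as is standard for Kripke semantics.
record Frame ℓ : Set (suc ℓ) where
  field
    W         : Set ℓ
    R         : Rel W ℓ
    inhabited : W

module _ {ℓ} (F : Frame ℓ) where
  open Frame F

  Sat : (ℕ → Pred W ℓ) → W → Form → Set ℓ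
  Sat V w (var i)  = w ∈ V i
  Sat V w ⊤'       = Unit.⊤
  Sat V w (σ ∧' τ) = Sat V w σ × Sat V w τ
  Sat V w (◇' σ)   = ∃ λ v → R w v × Sat V v σ

  ValidFrame : SpImp → Set (suc ℓ)
  ValidFrame (σ ⇒' τ) = ∀ (V : ℕ → Pred W ℓ) (w : W) → Sat V w σ → Sat V w τ

  ◇⁺ : Pred W ℓ → Pred W ℓ
  ◇⁺ X w = ∃ λ v → v ∈ X × R w v

  -- The powerset of W is Pred W ℓ, ordered by inclusion, with extensional
  -- equality ≐ of predicates.
  _⋆ : SLO (suc ℓ) ℓ ℓ
  _⋆ = record
    { boundedMeetSemilattice = record
      { Carrier = Pred W ℓ
      ; _≈_     = _≐_
      ; _≤_     = _⊆_
      ; _∧_     = _∩_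
      ; ⊤       = λ _ → Unit.⊤
      ; isBoundedMeetSemilattice = record
        { isMeetSemilattice = record
          { isPartialOrder = ⊆-isPartialOrder
          ; infimum = λ X Y → proj₁ , proj₂ , λ Z Z⊆X Z⊆Y z → Z⊆X z , Z⊆Y z
          }
        ; maximum = λ X _ → tt
        }
      }
    ; ◇      = ◇⁺
    ; ◇-mono = λ { X⊆Y (v , v∈X , Rwv) → v , X⊆Y v∈X , Rwv }
    }

record Embedding {a ℓ₁ ℓ₂ b ℓ₃ ℓ₄} (A : SLO a ℓ₁ ℓ₂) (B : SLO b ℓ₃ ℓ₄)
       : Set (a ⊔ ℓ₁ ⊔ b ⊔ ℓ₃) where
  private
    module A = SLO A
    module B = SLO B
  field
    f         : A.Carrier → B.Carrier
    cong      : Congruent A._≈_ B._≈_ f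
    injective : Injective A._≈_ B._≈_ f
    ∧-homo    : ∀ x y → f (x A.∧ y) B.≈ (f x B.∧ f y)
    ⊤-homo    : f A.⊤ B.≈ B.⊤
    ◇-homo    : ∀ x → f (A.◇ x) B.≈ B.◇ (f x)

_⊨ᴬ_ : ∀ {c ℓ₁ ℓ₂ ℓ} → SLO c ℓ₁ ℓ₂ → Pred SpImp ℓ → Set (c ⊔ ℓ₂ ⊔ ℓ)
A ⊨ᴬ L = ∀ ι → ι ∈ L → ValidSLO A ι

_⊨ᶠ_ : ∀ {ℓ ℓ′} → Frame ℓ → Pred SpImp ℓ′ → Set (suc ℓ ⊔ ℓ′)
F ⊨ᶠ L = ∀ ι → ι ∈ L → ValidFrame F ι

-- SLOs and frames range over an arbitrary but fixed universe level ℓ.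
SPi+ : ∀ ℓ → Pred SpImp 0ℓ → Pred SpImp (suc ℓ)
SPi+ ℓ Γ ι = ∀ (A : SLO ℓ ℓ ℓ) → A ⊨ᴬ Γ → ValidSLO A ι

FrameConsequences : ∀ ℓ → Pred SpImp 0ℓ → Pred SpImp (suc ℓ)
FrameConsequences ℓ Γ ι = ∀ (F : Frame ℓ) → F ⊨ᶠ Γ → ValidFrame F ι

Complete : ∀ ℓ → Pred SpImp 0ℓ → Set (suc ℓ)
Complete ℓ Γ = SPi+ ℓ Γ ≐ FrameConsequences ℓ Γ

Complex : ∀ ℓ → Pred SpImp (suc ℓ) → Set (suc ℓ)
Complex ℓ L = ∀ (A : SLO ℓ ℓ ℓ) → A ⊨ᴬ L →
  Σ (Frame ℓ) λ F → (F ⊨ᶠ L) × Embedding A (F ⋆)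

Γ-sym Γ-S5-sym Γ-S5-eucl : Pred SpImp 0ℓ
Γ-sym     = ｛ ι-sym ｝
Γ-S5-sym  = ｛ ι-refl ｝ ∪ ｛ ι-trans ｝ ∪ ｛ ι-sym ｝
Γ-S5-eucl = ｛ ι-refl ｝ ∪ ｛ ι-trans ｝ ∪ ｛ ι-eucl ｝

{-# OPTIONS --safe #-}

-- A symmetric SLO A embeds into 𝔉⋆, where the worlds of 𝔉 are the elements of
-- A, with R a b iff a ≤ ◇ b and b ≤ ◇ a, and x is sent to the set of all
-- a ≤ x.  A witness for a ≤ ◇ x is x ∧ ◇ a, since ι-sym gives
-- a ≤ a ∧ ◇ x ≤ ◇ (x ∧ ◇ a).  R is symmetric by construction, and it inherits
-- reflexivity and transitivity from A.  Elements thus serve as codes for the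
-- principal filters, which keeps the frame in the universe of A.

module Submission where

open import Defs
open import Level using (Level; suc; Lift; lift; lower; 0ℓ)
open import Data.Nat.Base using (ℕ)
open import Data.Product.Base using (_×_; _,_; proj₁; proj₂; swap)
open import Data.Sum.Base using (inj₁; inj₂)
open import Data.Unit.Polymorphic.Base using (tt)
open import Relation.Binary.Definitions using (Symmetric; Reflexive; Transitive)
open import Relation.Binary.PropositionalEquality.Core using (refl)
open import Relation.Unary using (Pred; _≐_; _⊆_)

private
  variable
    ℓ : Level

-- Soundness

module _ (F : Frame ℓ) where
  open Frame F

  -- F ⋆ lives one universe too high to instantiate SPi+ ℓ; this is the
  -- subalgebra of F ⋆ generated by V, with formulas naming its elements.
  definableSLO : (ℕ → Pred W ℓ) → SLO ℓ ℓ ℓ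
  definableSLO V = record
    { boundedMeetSemilattice = record
      { Carrier = Lift ℓ Form
      ; _≈_     = λ σ τ → ⟦ σ ⟧ ≐ ⟦ τ ⟧
      ; _≤_     = λ σ τ → ⟦ σ ⟧ ⊆ ⟦ τ ⟧
      ; _∧_     = λ σ τ → lift (lower σ ∧' lower τ)
      ; ⊤       = lift ⊤'
      ; isBoundedMeetSemilattice = record
        { isMeetSemilattice = record
          { isPartialOrder = record
            { isPreorder = record
              { isEquivalence = record
                { refl  = (λ s → s) , (λ s → s)
                ; sym   = swap
                ; trans = λ (f , f⁻¹) (g , g⁻¹) → (λ s → g (f s)) , (λ s → f⁻¹ (g⁻¹ s))
                }
              ; reflexive = proj₁
              ; trans     = λ f g s → g (f s)
              }
            ; antisym = _,_
            }
          ; infimum = λ _ _ → proj₁ , proj₂ , λ _ f g s → f s , g s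
          }
        ; maximum = λ _ _ → tt
        }
      }
    ; ◇      = λ σ → lift (◇' lower σ)
    ; ◇-mono = λ σ⊆τ (v , Rwv , s) → v , Rwv , σ⊆τ s
    }
    where
    ⟦_⟧ : Lift ℓ Form → Pred W ℓ
    ⟦ σ ⟧ w = Sat F V w (lower σ)

  module _ (V : ℕ → Pred W ℓ) (𝔞 : ℕ → Lift ℓ Form) where
    private
      V[𝔞] : ℕ → Pred W ℓ
      V[𝔞] i w = Sat F V w (lower (𝔞 i))

    -- Evaluation in `definableSLO V` under `𝔞` is syntactic substitution, so this and its converse
    -- form the substitution lemma, by induction on the formula.
    Sat-subst⁺ : ∀ σ {w} → Sat F V[𝔞] w σ → Sat F V w (lower (eval (definableSLO V) 𝔞 σ))
    Sat-subst⁻ : ∀ σ {w} → Sat F V w (lower (eval (definableSLO V) 𝔞 σ)) → Sat F V[𝔞] w σ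

    Sat-subst⁺ (var i)  s             = s
    Sat-subst⁺ ⊤'       s             = s
    Sat-subst⁺ (σ ∧' τ) (s , t)       = Sat-subst⁺ σ s , Sat-subst⁺ τ t
    Sat-subst⁺ (◇' σ)   (v , Rwv , s) = v , Rwv , Sat-subst⁺ σ s

    Sat-subst⁻ (var i)  s             = s
    Sat-subst⁻ ⊤'       s             = s
    Sat-subst⁻ (σ ∧' τ) (s , t)       = Sat-subst⁻ σ s , Sat-subst⁻ τ t
    Sat-subst⁻ (◇' σ)   (v , Rwv , s) = v , Rwv , Sat-subst⁻ σ s

  -- The truth sets of the formulas `𝔞 i` are one more valuation on `F`, to which frame validity
  -- applies.
  definableSLO-valid : ∀ V ι → ValidFrame F ι → ValidSLO (definableSLO V) ι
  definableSLO-valid V (σ ⇒' τ) valid 𝔞 {w} s =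
    Sat-subst⁺ V 𝔞 τ (valid _ w (Sat-subst⁻ V 𝔞 σ s))

  -- Reduces validity of a whole logic, as `Complex` demands, to that of its axioms. Under `vars`
  -- each variable names its own value under `V`.
  ⊨ᶠ-SPi+ : {Γ : Pred SpImp 0ℓ} → F ⊨ᶠ Γ → F ⊨ᶠ SPi+ ℓ Γ
  ⊨ᶠ-SPi+ F⊨Γ (σ ⇒' τ) ι∈SPi V w s =
    Sat-subst⁻ V vars τ (ι∈SPi (definableSLO V) A⊨Γ vars (Sat-subst⁺ V vars σ s))
    where
    vars : ℕ → Lift ℓ Form
    vars i = lift (var i)

    A⊨Γ : definableSLO V ⊨ᴬ _
    A⊨Γ ι ι∈Γ = definableSLO-valid V ι (F⊨Γ ι ι∈Γ)

Γ⊆SPi+ : {Γ : Pred SpImp 0ℓ} → ∀ ι → Γ ι → SPi+ ℓ Γ ι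
Γ⊆SPi+ ι ι∈Γ A A⊨Γ = A⊨Γ ι ι∈Γ

-- Complexity implies completeness

module _ (A : SLO ℓ ℓ ℓ) (F : Frame ℓ) (e : Embedding A (F ⋆)) where
  open SLO A
  open Embedding e

  -- An `Embedding` speaks of `≈` and the operations, not of `≤`, so the order is recovered from
  -- meets.
  embedding-reflects-≤ : ∀ {x y} → f x ⊆ f y → x ≤ y
  embedding-reflects-≤ {x} {y} fx⊆fy = trans (reflexive (Eq.sym x∧y≈x)) (x∧y≤y x y)
    where
    x∧y≈x : (x ∧ y) ≈ x
    x∧y≈x = injective
      ( (λ s → proj₁ (proj₁ (∧-homo x y) s))
      , (λ s → proj₂ (∧-homo x y) (s , fx⊆fy s)))

  module _ (𝔞 : ℕ → Carrier) where
    private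
      V : ℕ → Pred (Frame.W F) _
      V i = f (𝔞 i)

    -- With its converse, a truth lemma: `f` sends the value of a formula to its truth set under
    -- `V`, since sp-formulas use only operations that `f` preserves.
    embedding⇒Sat : ∀ σ {w} → f (eval A 𝔞 σ) w → Sat F V w σ
    embedding⇒Sat (var i)  s = s
    embedding⇒Sat ⊤'       s = tt
    embedding⇒Sat (σ ∧' τ) s with s₁ , s₂ ← proj₁ (∧-homo _ _) s =
      embedding⇒Sat σ s₁ , embedding⇒Sat τ s₂
    embedding⇒Sat (◇' σ)   s with v , t , Rwv ← proj₁ (◇-homo _) s =
      v , Rwv , embedding⇒Sat σ t

    Sat⇒embedding : ∀ σ {w} → Sat F V w σ → f (eval A 𝔞 σ) w
    Sat⇒embedding (var i)  s             = s
    Sat⇒embedding ⊤'       s             = proj₂ ⊤-homo tt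
    Sat⇒embedding (σ ∧' τ) (s , t)       = proj₂ (∧-homo _ _) (Sat⇒embedding σ s , Sat⇒embedding τ t)
    Sat⇒embedding (◇' σ)   (v , Rwv , s) = proj₂ (◇-homo _) (v , Sat⇒embedding σ s , Rwv)

  embedding-valid : ∀ ι → ValidFrame F ι → ValidSLO A ι
  embedding-valid (σ ⇒' τ) valid 𝔞 =
    embedding-reflects-≤ λ s → Sat⇒embedding 𝔞 τ (valid _ _ (embedding⇒Sat 𝔞 σ s))

-- An SLO validating `Γ` validates all of `SPi+ ℓ Γ` by definition, so it embeds into `F ⋆` for some
-- `F` validating `Γ`, and validity descends along the embedding. The other inclusion is soundness.
complex⇒complete : {Γ : Pred SpImp 0ℓ} → Complex ℓ (SPi+ ℓ Γ) → Complete ℓ Γ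
complex⇒complete {ℓ} {Γ} complex = (λ {ι} → sound ι) , (λ {ι} → complete ι)
  where
  sound : ∀ ι → SPi+ ℓ Γ ι → FrameConsequences ℓ Γ ι
  sound ι ι∈SPi F F⊨Γ = ⊨ᶠ-SPi+ F F⊨Γ ι ι∈SPi

  complete : ∀ ι → FrameConsequences ℓ Γ ι → SPi+ ℓ Γ ι
  complete ι ι∈FC A A⊨Γ
    with F , F⊨L , e ← complex A (λ κ κ∈SPi → κ∈SPi A A⊨Γ)
    = embedding-valid A F e ι (ι∈FC F λ κ κ∈Γ → F⊨L κ (Γ⊆SPi+ κ κ∈Γ))

Complex-resp-≐ : {L L′ : Pred SpImp (suc ℓ)} → L ≐ L′ → Complex ℓ L → Complex ℓ L′
Complex-resp-≐ (L⊆L′ , L′⊆L) complex A A⊨L′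
  with F , F⊨L , e ← complex A (λ ι ι∈L → A⊨L′ ι (L⊆L′ ι∈L))
  = F , (λ ι ι∈L′ → F⊨L ι (L′⊆L ι∈L′)) , e

-- Frame correspondence

module _ (F : Frame ℓ) where
  open Frame F

  symmetric⇒ι-sym : Symmetric R → ValidFrame F ι-sym
  symmetric⇒ι-sym sym V w (w∈q , v , Rwv , v∈p) = v , Rwv , v∈p , w , sym Rwv , w∈q

  reflexive⇒ι-refl : Reflexive R → ValidFrame F ι-refl
  reflexive⇒ι-refl rfl V w w∈p = w , rfl , w∈p

  transitive⇒ι-trans : Transitive R → ValidFrame F ι-trans
  transitive⇒ι-trans trans V w (v , Rwv , u , Rvu , u∈p) = u , trans Rwv Rvu , u∈p

-- The frame of elements

module _ (A : SLO ℓ ℓ ℓ) where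
  open SLO A renaming (refl to ≤-refl)

  -- Variable 0 is `p` and variable 1 is `q`; all further variables default to the second argument.
  valuation : Carrier → Carrier → ℕ → Carrier
  valuation x y 0 = x
  valuation x y _ = y

  ι-sym⇒≤ : ValidSLO A ι-sym → ∀ x y → y ∧ ◇ x ≤ ◇ (x ∧ ◇ y)
  ι-sym⇒≤ valid x y = valid (valuation x y)

  ι-eucl⇒≤ : ValidSLO A ι-eucl → ∀ x y → ◇ x ∧ ◇ y ≤ ◇ (x ∧ ◇ y)
  ι-eucl⇒≤ valid x y = valid (valuation x y)

  ι-refl⇒≤ : ValidSLO A ι-refl → ∀ x → x ≤ ◇ x
  ι-refl⇒≤ valid x = valid λ _ → x

  ι-trans⇒≤ : ValidSLO A ι-trans → ∀ x → ◇ (◇ x) ≤ ◇ x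
  ι-trans⇒≤ valid x = valid λ _ → x

  ∧-monoʳ : ∀ {x y} z → x ≤ y → z ∧ x ≤ z ∧ y
  ∧-monoʳ {x} z x≤y = ∧-greatest (x∧y≤x z x) (trans (x∧y≤y z x) x≤y)

  -- Symmetry with `◇ q` in place of `q` yields `◇ (p ∧ ◇ ◇ q)`; transitivity then collapses the
  -- double diamond.
  ι-sym∧ι-trans⇒ι-eucl : ValidSLO A ι-sym → ValidSLO A ι-trans → ValidSLO A ι-eucl
  ι-sym∧ι-trans⇒ι-eucl sym tr 𝔞 =
    trans (∧-greatest (x∧y≤y _ _) (x∧y≤x _ _))
      (trans (ι-sym⇒≤ sym (𝔞 0) (◇ (𝔞 1))) (◇-mono (∧-monoʳ _ (ι-trans⇒≤ tr (𝔞 1)))))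

  -- Reflexivity weakens `q` to `◇ q`, which supplies the missing conjunct of the Euclidean premise.
  ι-eucl∧ι-refl⇒ι-sym : ValidSLO A ι-eucl → ValidSLO A ι-refl → ValidSLO A ι-sym
  ι-eucl∧ι-refl⇒ι-sym eucl rfl 𝔞 =
    trans (∧-greatest (x∧y≤y _ _) (trans (x∧y≤x _ _) (ι-refl⇒≤ rfl (𝔞 1))))
      (ι-eucl⇒≤ eucl (𝔞 0) (𝔞 1))

  elementFrame : Frame ℓ
  elementFrame = record
    { W         = Carrier
    ; R         = λ a b → a ≤ ◇ b × b ≤ ◇ a
    ; inhabited = ⊤
    }

  open Frame elementFrame using (R)

  elementFrame-reflexive : ValidSLO A ι-refl → Reflexive R
  elementFrame-reflexive rfl = ι-refl⇒≤ rfl _ , ι-refl⇒≤ rfl _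

  elementFrame-transitive : ValidSLO A ι-trans → Transitive R
  elementFrame-transitive tr (a≤◇b , b≤◇a) (b≤◇c , c≤◇b) =
    trans a≤◇b (trans (◇-mono b≤◇c) (ι-trans⇒≤ tr _)) ,
    trans c≤◇b (trans (◇-mono b≤◇a) (ι-trans⇒≤ tr _))

  downset-embedding : ValidSLO A ι-sym → Embedding A (elementFrame ⋆)
  downset-embedding sym = record
    { f         = λ x a → a ≤ x
    ; cong      = λ x≈y → (λ a≤x → trans a≤x (reflexive x≈y))
                        , (λ a≤y → trans a≤y (reflexive (Eq.sym x≈y)))
    ; injective = λ (↓x⊆↓y , ↓y⊆↓x) → antisym (↓x⊆↓y ≤-refl) (↓y⊆↓x ≤-refl)
    ; ∧-homo    = λ x y → (λ a≤x∧y → trans a≤x∧y (x∧y≤x x y) , trans a≤x∧y (x∧y≤y x y))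
                        , (λ (a≤x , a≤y) → ∧-greatest a≤x a≤y)
    ; ⊤-homo    = (λ _ → tt) , (λ _ → maximum _)
    ; ◇-homo    = λ x →
        (λ {a} a≤◇x → x ∧ ◇ a , x∧y≤x x (◇ a)
                    , trans (∧-greatest ≤-refl a≤◇x) (ι-sym⇒≤ sym x a)
                    -- The conjunct `◇ a` of the witness secures the backward half of `R`.
                    , x∧y≤y x (◇ a))
      , (λ (b , b≤x , a≤◇b , _) → trans a≤◇b (◇-mono b≤x))
    }

-- Complexity of the logics and equality of the two S5 axiomatizations

sym-complex : ∀ ℓ → Complex ℓ (SPi+ ℓ Γ-sym)
sym-complex ℓ A A⊨L =
    elementFrame A
  , ⊨ᶠ-SPi+ _ (λ { _ refl → symmetric⇒ι-sym (elementFrame A) swap })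
  , downset-embedding A (A⊨L ι-sym (Γ⊆SPi+ ι-sym refl))

S5-sym-complex : ∀ ℓ → Complex ℓ (SPi+ ℓ Γ-S5-sym)
S5-sym-complex ℓ A A⊨L =
    elementFrame A
  , ⊨ᶠ-SPi+ _ (λ
      { _ (inj₁ refl)        → reflexive⇒ι-refl (elementFrame A) (elementFrame-reflexive A (A⊨Γ _ (inj₁ refl)))
      ; _ (inj₂ (inj₁ refl)) → transitive⇒ι-trans (elementFrame A) (elementFrame-transitive A (A⊨Γ _ (inj₂ (inj₁ refl))))
      ; _ (inj₂ (inj₂ refl)) → symmetric⇒ι-sym (elementFrame A) swap
      })
  , downset-embedding A (A⊨Γ _ (inj₂ (inj₂ refl)))
  where
  A⊨Γ : A ⊨ᴬ Γ-S5-sym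
  A⊨Γ ι ι∈Γ = A⊨L ι (Γ⊆SPi+ ι ι∈Γ)

-- Inclusion of logics is contravariant in their models: each direction shows that a model of the
-- target axioms satisfies the source axioms, and only the unshared axiom has to be derived.
S5-sym≐S5-eucl : ∀ ℓ → SPi+ ℓ Γ-S5-sym ≐ SPi+ ℓ Γ-S5-eucl
S5-sym≐S5-eucl ℓ =
    (λ ι∈L A A⊨eucl → ι∈L A λ
      { _ (inj₁ refl)        → A⊨eucl _ (inj₁ refl)
      ; _ (inj₂ (inj₁ refl)) → A⊨eucl _ (inj₂ (inj₁ refl))
      ; _ (inj₂ (inj₂ refl)) →
          ι-eucl∧ι-refl⇒ι-sym A (A⊨eucl _ (inj₂ (inj₂ refl))) (A⊨eucl _ (inj₁ refl))
      })
  , (λ ι∈L A A⊨sym → ι∈L A λ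
      { _ (inj₁ refl)        → A⊨sym _ (inj₁ refl)
      ; _ (inj₂ (inj₁ refl)) → A⊨sym _ (inj₂ (inj₁ refl))
      ; _ (inj₂ (inj₂ refl)) →
          ι-sym∧ι-trans⇒ι-eucl A (A⊨sym _ (inj₂ (inj₂ refl))) (A⊨sym _ (inj₂ (inj₁ refl)))
      })

theorem5p14 : ∀ (ℓ : Level) →
    (Complex ℓ (SPi+ ℓ Γ-sym) × Complete ℓ Γ-sym)
    × (SPi+ ℓ Γ-S5-sym ≐ SPi+ ℓ Γ-S5-eucl)
    × (Complex ℓ (SPi+ ℓ Γ-S5-sym) × Complete ℓ Γ-S5-sym)
    × (Complex ℓ (SPi+ ℓ Γ-S5-eucl) × Complete ℓ Γ-S5-eucl)
theorem5p14 ℓ =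
    (sym-complex ℓ , complex⇒complete (sym-complex ℓ))
  , S5-sym≐S5-eucl ℓ
  , (S5-sym-complex ℓ , complex⇒complete (S5-sym-complex ℓ))
  , (S5-eucl-complex , complex⇒complete S5-eucl-complex)
  where
  S5-eucl-complex : Complex ℓ (SPi+ ℓ Γ-S5-eucl)
  S5-eucl-complex = Complex-resp-≐ (S5-sym≐S5-eucl ℓ) (S5-sym-complex ℓ)
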